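{- For every odd period $\Delta\ge 1$ and minimum slack $k=0$ there is a gadget $G_{\Delta,0}$, i.e. a realizable instance of $\Delta$-$0$-DiTTR, that enforces $\lambda(v_1,v_2)=\lambda(v_2,v_1)$ for some pair of adjacent vertices $(v_1,v_2)$.
   Context: All graphs are finite. A $\Delta$-periodic labeling of a directed graph $G=(V,E)$ is a map $\lambda:E\to\{0,1,\dots,\Delta-1\}$; edge $e$ is then active exactly at the times $\lambda(e)+i\Delta$, $i\in\mathbb{N}_0$. A temporal $s$-$z$-path is a sequence $(v_{i-1},v_i,t_i)_{i=1}^{\ell}$ with $v_0=s$, $v_\ell=z$, pairwise distinct vertices $v_0,\dots,v_\ell$, $(v_{i-1},v_i)\in E$ active at time $t_i$ for every $i$, and $t_1<t_2<\dots<t_\ell$ (strictly increasing). Its duration is $t_\ell+1-t_1$. A fastest temporal path is one of minimum duration. $\hat d(u,v)$ is the distance from $u$ to $v$ in the static graph $G$ (all edges have unit length). A bidirected tree is the directed graph obtained from an undirected tree by replacing each edge $\{u,v\}$ by the two directed edges $(u,v),(v,u)$ (which may get different labels). For integers $\Delta\ge1,k\ge0$, an instance of $\Delta$-$k$-DiTTR consists of a bidirected tree $G=(V,E)$ and a matrix $D$ indexed by $V\times V$ with entries positive integers or $\infty$ (no restriction) such that $D_{u,v}\ge\hat d(u,v)+k$ for all $u,v$. A valid labeling is a $\Delta$-periodic labeling $\lambda$ of $E$ such that, for all $u,v\in V$, the duration of a fastest temporal path from $u$ to $v$ is at most $D_{u,v}$; the instance is realizable if a valid labeling exists. Diagonal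 entries of $D$ play no role; all conditions on $D$ are for distinct vertices. An instance enforces $\lambda(v_1,v_2)=\lambda(v_2,v_1)$ if this equality holds for every valid labeling $\lambda$. -}

module Defs where

open import Data.Bool.Base using (Bool; T)
open import Data.Fin.Base using (Fin; zero; suc; inject₁; fromℕ; toℕ)
import Data.Fin.Base as Fin
open import Data.Nat.Base using (ℕ; suc; _+_; _*_; _∸_; _≤_; _<_; NonZero)
open import Data.Product.Base using (Σ; Σ-syntax; ∃-syntax; _×_)
open import Function.Definitions using (Injective)
open import Relation.Binary.PropositionalEquality.Core using (_≡_; _≢_)
open import Relation.Nullary.Negation.Core using (¬_)
open import Relation.Nullary.Construct.Add.Supremum using (_⁺; [_])
open import Relation.Binary.Construct.Add.Supremum.NonStrict _≤_ using (_≤⁺_)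

record Digraph : Set where
  field
    order : ℕ
    edge  : Fin order → Fin order → Bool

  Vertex : Set
  Vertex = Fin order

  Edge : Vertex → Vertex → Set
  Edge u v = T (edge u v)

record Graph : Set where
  field
    order       : ℕ
    adj         : Fin order → Fin order → Bool
    symmetric   : ∀ u v → T (adj u v) → T (adj v u)
    irreflexive : ∀ u → ¬ T (adj u u)

bidirect : Graph → Digraph
bidirect G = record { order = order ; edge = adj }
  where open Graph G

record Path (G : Digraph) (s z : Digraph.Vertex G) : Set where
  open Digraph G
  field
    len      : ℕ
    vertex   : Fin (suc len) → Vertex
    start    : vertex zero ≡ s
    end      : vertex (fromℕ len) ≡ z
    distinct : Injective _≡_ _≡_ vertex
    edges    : (i : Fin len) → Edge (vertex (inject₁ i)) (vertex (suc i))

IsDistance : (G : Digraph) (u v : Digraph.Vertex G) → ℕ → Set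
IsDistance G u v d =
  (Σ[ P ∈ Path G u v ] Path.len P ≡ d) × ((P : Path G u v) → d ≤ Path.len P)

-- Paths of an undirected graph are those of its bidirection.  A cycle is a path
-- on at least three vertices together with an edge joining its two ends.
record Tree : Set where
  field
    graph     : Graph
    nonempty  : NonZero (Graph.order graph)
    connected : ∀ u v → Path (bidirect graph) u v
    acyclic   : ∀ u v → (P : Path (bidirect graph) u v) →
                2 ≤ Path.len P → ¬ T (Graph.adj graph v u)

  digraph : Digraph
  digraph = bidirect graph

  open Digraph digraph public

  reverse : ∀ {u v} → Edge u v → Edge v u
  reverse {u} {v} = Graph.symmetric graph u v

Labeling : ℕ → Digraph → Set
Labeling Δ G = (u v : Digraph.Vertex G) → Digraph.Edge G u v → Fin Δ

ActiveAt : ∀ {Δ} (G : Digraph) (lab : Labeling Δ G) {u v : Digraph.Vertex G} →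
           Digraph.Edge G u v → ℕ → Set
ActiveAt {Δ} G lab {u} {v} e t = ∃[ i ] t ≡ toℕ (lab u v e) + i * Δ

-- Only temporal paths with at least one edge are considered, since the duration
-- refers to the first and the last time step; len⁻ is the number of edges minus one.
record TemporalPath {Δ : ℕ} (G : Digraph) (lab : Labeling Δ G)
                    (s z : Digraph.Vertex G) : Set where
  open Digraph G
  field
    len⁻       : ℕ
    vertex     : Fin (suc (suc len⁻)) → Vertex
    time       : Fin (suc len⁻) → ℕ
    start      : vertex zero ≡ s
    end        : vertex (fromℕ (suc len⁻)) ≡ z
    distinct   : Injective _≡_ _≡_ vertex
    edges      : ∀ i → Edge (vertex (inject₁ i)) (vertex (suc i))
    active     : ∀ i → ActiveAt G lab (edges i) (time i)
    increasing : ∀ i j → i Fin.< j → time i < time j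

  duration : ℕ
  duration = time (fromℕ len⁻) + 1 ∸ time zero

open TemporalPath using (duration)

IsFastest : ∀ {Δ} (G : Digraph) (lab : Labeling Δ G) {s z : Digraph.Vertex G} →
            TemporalPath G lab s z → Set
IsFastest G lab {s} {z} P = (Q : TemporalPath G lab s z) → duration P ≤ duration Q

-- Matrix entries live in ℕ ⁺, i.e. ℕ with a top element playing the role of ∞.
-- The period Δ does not constrain the data of an instance, only its labelings.
record DiTTR (Δ k : ℕ) : Set where
  field
    tree : Tree

  open Tree tree public

  field
    D        : Vertex → Vertex → ℕ ⁺
    positive : ∀ u v → u ≢ v → [ 1 ] ≤⁺ D u v
    slack    : ∀ u v → u ≢ v → ∀ d → IsDistance digraph u v d → [ d + k ] ≤⁺ D u v

module _ {Δ k : ℕ} (I : DiTTR Δ k) where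
  open DiTTR I

  Valid : Labeling Δ digraph → Set
  Valid lab = ∀ u v → u ≢ v →
    Σ[ P ∈ TemporalPath digraph lab u v ]
      IsFastest digraph lab P × [ duration P ] ≤⁺ D u v

  Realizable : Set
  Realizable = Σ (Labeling Δ digraph) Valid

  EnforcesEqual : (v₁ v₂ : Vertex) → Edge v₁ v₂ → Set
  EnforcesEqual v₁ v₂ e = (lab : Labeling Δ digraph) → Valid lab →
    lab v₁ v₂ e ≡ lab v₂ v₁ (reverse e)

{-# OPTIONS --safe #-}
module Submission where

-- If D is the distance matrix of a tree, then a labeling is valid exactly when the
-- labels of any two successive edges of a path are consecutive modulo Δ.  Around a vertex
-- with three neighbours this forces a common label a on all incoming edges and a + 1
-- on all outgoing ones.  Along a path leaving such a vertex the outward labels grow and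
-- the inward labels decrease by one per edge, so their difference on the i-th edge
-- is 2 i - 1, which vanishes modulo an odd Δ for i = (Δ + 1) / 2.

open import Defs
open import Data.Bool.Base using (Bool; true; false; T)
open import Data.Bool.Properties using (T-irrelevant)
open import Data.Fin.Base using (Fin; zero; suc; inject₁; fromℕ; toℕ)
open import Data.Fin.Patterns using (1F; 2F)
import Data.Fin.Base as Fin
import Data.Fin.Properties as Fin
open import Data.Nat.Base using (ℕ; zero; suc; _+_; _*_; _∸_; _≤_; _<_; z≤n; s≤s; NonZero)
open import Data.Nat.DivMod using (_%_; _/_; _mod_; m≡m%n+[m/n]*n; m%n<n; m<n⇒m%n≡m; [m+kn]%n≡m%n)
open import Data.Nat.Divisibility using (_∣_; m%n≡0⇒n∣m)
open import Data.Nat.Properties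
open import Data.Nat.Tactic.RingSolver using (solve-∀)
open import Data.Product.Base using (Σ-syntax; ∃-syntax; _×_; _,_)
open import Data.Sum.Base using (_⊎_; inj₁; inj₂)
open import Function.Base using (_∘_)
open import Function.Definitions using (Injective)
open import Relation.Binary.Construct.Add.Supremum.NonStrict _≤_ using (_≤⁺_; [_])
open import Relation.Binary.PropositionalEquality
open import Relation.Nullary.Construct.Add.Supremum using ([_])
open import Relation.Nullary.Decidable.Core using (yes; no)
open import Relation.Nullary.Negation.Core using (¬_; contradiction)

-- Arithmetic of times: congruence modulo the period, increasing sequences.

module Modulo (Δ : ℕ) where

  infix 4 _≈_

  -- Congruence modulo `Δ` without subtraction: multiples may be added on both sides, so symmetry is
  -- a swap and cancelling `suc` is injectivity of `suc`.
  record _≈_ (x y : ℕ) : Set where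
    constructor mk≈
    field
      i j   : ℕ
      equal : x + i * Δ ≡ y + j * Δ

  ≈-reflexive : ∀ {x y} → x ≡ y → x ≈ y
  ≈-reflexive eq = mk≈ 0 0 (cong (_+ 0) eq)

  ≈-sym : ∀ {x y} → x ≈ y → y ≈ x
  ≈-sym (mk≈ i j eq) = mk≈ j i (sym eq)

  private
    shift : ∀ x i k d → x + (i + k) * d ≡ (x + i * d) + k * d
    shift = solve-∀

    swap : ∀ x i k d → (x + i * d) + k * d ≡ (x + k * d) + i * d
    swap = solve-∀

  ≈-trans : ∀ {x y z} → x ≈ y → y ≈ z → x ≈ z
  ≈-trans {x} {y} {z} (mk≈ i j p) (mk≈ k l q) = mk≈ (i + k) (l + j) (begin
    x + (i + k) * Δ      ≡⟨ shift x i k Δ ⟩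
    x + i * Δ + k * Δ    ≡⟨ cong (_+ k * Δ) p ⟩
    y + j * Δ + k * Δ    ≡⟨ swap y j k Δ ⟩
    y + k * Δ + j * Δ    ≡⟨ cong (_+ j * Δ) q ⟩
    z + l * Δ + j * Δ    ≡⟨ shift z l j Δ ⟨
    z + (l + j) * Δ      ∎)
    where open ≡-Reasoning

  ≈-suc : ∀ {x y} → x ≈ y → suc x ≈ suc y
  ≈-suc (mk≈ i j eq) = mk≈ i j (cong suc eq)

  ≈-pred : ∀ {x y} → suc x ≈ suc y → x ≈ y
  ≈-pred (mk≈ i j eq) = mk≈ i j (suc-injective eq)

  ≈-+ˡ : ∀ m {x y} → x ≈ y → m + x ≈ m + y
  ≈-+ˡ zero    p = p
  ≈-+ˡ (suc m) p = ≈-suc (≈-+ˡ m p)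

  +Δ≈ : ∀ x → x + Δ ≈ x
  +Δ≈ x = mk≈ 0 1 (lemma x Δ)
    where
    lemma : ∀ x d → x + d + 0 * d ≡ x + 1 * d
    lemma = solve-∀

  module _ .{{_ : NonZero Δ}} where

    ≈⇒%≡% : ∀ {x y} → x ≈ y → x % Δ ≡ y % Δ
    ≈⇒%≡% {x} {y} (mk≈ i j eq) = begin
      x % Δ            ≡⟨ [m+kn]%n≡m%n x i Δ ⟨
      (x + i * Δ) % Δ  ≡⟨ cong (_% Δ) eq ⟩
      (y + j * Δ) % Δ  ≡⟨ [m+kn]%n≡m%n y j Δ ⟩
      y % Δ            ∎
      where open ≡-Reasoning

    toℕ-≈-injective : ∀ {a b : Fin Δ} → toℕ a ≈ toℕ b → a ≡ b
    toℕ-≈-injective {a} {b} p = Fin.toℕ-injective (begin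
      toℕ a      ≡⟨ m<n⇒m%n≡m (Fin.toℕ<n a) ⟨
      toℕ a % Δ  ≡⟨ ≈⇒%≡% p ⟩
      toℕ b % Δ  ≡⟨ m<n⇒m%n≡m (Fin.toℕ<n b) ⟩
      toℕ b      ∎)
      where open ≡-Reasoning

    toℕ-mod-≈ : ∀ x → toℕ (x mod Δ) ≈ x
    toℕ-mod-≈ x = mk≈ (x / Δ) 0 (begin
      toℕ (x mod Δ) + x / Δ * Δ  ≡⟨ cong (_+ x / Δ * Δ) (Fin.toℕ-fromℕ< (m%n<n x Δ)) ⟩
      x % Δ + x / Δ * Δ          ≡⟨ m≡m%n+[m/n]*n x Δ ⟨
      x                          ≡⟨ +-identityʳ x ⟨
      x + 0                      ∎)
      where open ≡-Reasoning

    -- A label is less than `Δ`, so it is the remainder of any congruent `t`; the quotient then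
    -- counts the periods elapsed, and `t` cannot precede the label.
    active-≈ : ∀ (a : Fin Δ) {t} → toℕ a ≈ t → ∃[ i ] t ≡ toℕ a + i * Δ
    active-≈ a {t} p = t / Δ , (begin
      t                    ≡⟨ m≡m%n+[m/n]*n t Δ ⟩
      t % Δ + t / Δ * Δ    ≡⟨ cong (_+ t / Δ * Δ) (≈⇒%≡% p) ⟨
      toℕ a % Δ + t / Δ * Δ  ≡⟨ cong (_+ t / Δ * Δ) (m<n⇒m%n≡m (Fin.toℕ<n a)) ⟩
      toℕ a + t / Δ * Δ    ∎)
      where open ≡-Reasoning

    ≈-active : ∀ {a t} → ∃[ i ] t ≡ a + i * Δ → a ≈ t
    ≈-active {a} {t} (i , eq) = mk≈ i 0 (trans (sym eq) (sym (+-identityʳ t)))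

-- Natural times gain at least one per edge. This bounds durations below by the number of edges.
increasing⇒+≤ : ∀ {n} (t : Fin (suc n) → ℕ) → (∀ i j → i Fin.< j → t i < t j) →
                n + t zero ≤ t (fromℕ n)
increasing⇒+≤ {zero}  t incr = ≤-refl
increasing⇒+≤ {suc n} t incr = begin
  suc n + t zero      ≡⟨ +-suc n (t zero) ⟨
  n + suc (t zero)    ≤⟨ +-monoʳ-≤ n (incr zero 1F (s≤s z≤n)) ⟩
  n + t 1F            ≤⟨ increasing⇒+≤ (t ∘ suc) (λ i j i<j → incr (suc i) (suc j) (s≤s i<j)) ⟩
  t (fromℕ (suc n))   ∎
  where open ≤-Reasoning

-- Tree metrics and their paths

-- A distance function in which every vertex w ≢ z has exactly one neighbour closer
-- to z and all its other neighbours are farther away exists only on trees.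
record TreeMetric (G : Graph) : Set where
  open Digraph (bidirect G)
  field
    dist          : Vertex → Vertex → ℕ
    dist-refl     : ∀ u → dist u u ≡ 0
    dist≡0⇒≡      : ∀ {u v} → dist u v ≡ 0 → u ≡ v
    dist-step     : ∀ {u w} → Edge u w → ∀ z →
                    dist u z ≡ suc (dist w z) ⊎ dist w z ≡ suc (dist u z)
    closer        : ∀ {d} u z → dist u z ≡ suc d → Σ[ w ∈ Vertex ] Edge u w × dist w z ≡ d
    closer-unique : ∀ {w u v} z → Edge w u → Edge w v →
                    dist w z ≡ suc (dist u z) → dist w z ≡ suc (dist v z) → u ≡ v

module _ {G : Graph} (M : TreeMetric G) where
  open Digraph (bidirect G)
  open TreeMetric M

  dist-edge : ∀ {u v} → Edge u v → dist u v ≡ 1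
  dist-edge {u} {v} e with dist-step e v
  ... | inj₁ eq = trans eq (cong suc (dist-refl v))
  ... | inj₂ eq = contradiction (trans (sym (dist-refl v)) eq) 0≢1+n

  dist-2 : ∀ {u m v} → Edge u m → Edge m v → u ≢ v → dist u v ≡ 2
  dist-2 {u} {m} {v} e e′ u≢v with dist-step e v
  ... | inj₁ eq = trans eq (cong suc (dist-edge e′))
  ... | inj₂ eq = contradiction (dist≡0⇒≡ (suc-injective (trans (sym eq) (dist-edge e′)))) u≢v

  -- If the first step led away from the end, the second one would have to go back.
  dist-path : ∀ n (f : Fin (suc n) → Vertex) → Injective _≡_ _≡_ f →
              (∀ i → Edge (f (inject₁ i)) (f (suc i))) → dist (f zero) (f (fromℕ n)) ≡ n
  dist-path zero          f inj es = dist-refl (f zero)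
  dist-path (suc zero)    f inj es = dist-edge (es zero)
  dist-path (suc (suc n)) f inj es
    with dist-path (suc n) (f ∘ suc) (Fin.suc-injective ∘ inj) (es ∘ suc)
       | dist-path n (λ i → f (suc (suc i))) (Fin.suc-injective ∘ Fin.suc-injective ∘ inj)
           (λ i → es (suc (suc i)))
       | dist-step (es zero) (f (fromℕ (suc (suc n))))
  ... | p | q | inj₁ eq = trans eq (cong suc p)
  ... | p | q | inj₂ eq = contradiction
    (inj (closer-unique _ (Graph.symmetric G _ _ (es zero)) (es 1F) eq (trans p (cong suc (sym q)))))
    λ ()

  -- The distance is a separate index `d`, so that the walk along `closer` is structurally
  -- recursive.
  geodesic : ∀ {d} u z → dist u z ≡ d → Fin (suc d) → Vertex
  geodesic         u z eq zero    = u
  geodesic {suc d} u z eq (suc i) = let w , _ , eq′ = closer u z eq in geodesic w z eq′ i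

  geodesic-dist : ∀ {d} u z (eq : dist u z ≡ d) i → toℕ i + dist (geodesic u z eq i) z ≡ d
  geodesic-dist         u z eq zero    = eq
  geodesic-dist {suc d} u z eq (suc i) =
    let w , _ , eq′ = closer u z eq in cong suc (geodesic-dist w z eq′ i)

  geodesic-end : ∀ {d} u z (eq : dist u z ≡ d) → geodesic u z eq (fromℕ d) ≡ z
  geodesic-end {zero}  u z eq = dist≡0⇒≡ eq
  geodesic-end {suc d} u z eq = let w , _ , eq′ = closer u z eq in geodesic-end w z eq′

  geodesic-edges : ∀ {d} u z (eq : dist u z ≡ d) (i : Fin d) →
                   Edge (geodesic u z eq (inject₁ i)) (geodesic u z eq (suc i))
  geodesic-edges u z eq zero    = let _ , e , _ = closer u z eq in e
  geodesic-edges u z eq (suc i) = let w , _ , eq′ = closer u z eq in geodesic-edges w z eq′ i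

  -- Position plus remaining distance to `z` is constant, so the vertex determines its position.
  geodesic-distinct : ∀ {d} u z (eq : dist u z ≡ d) → Injective _≡_ _≡_ (geodesic u z eq)
  geodesic-distinct u z eq {i} {j} same = Fin.toℕ-injective (+-cancelʳ-≡ _ (toℕ i) (toℕ j) (begin
    toℕ i + dist (geodesic u z eq i) z  ≡⟨ geodesic-dist u z eq i ⟩
    _                                   ≡⟨ geodesic-dist u z eq j ⟨
    toℕ j + dist (geodesic u z eq j) z  ≡⟨ cong (λ w → toℕ j + dist w z) same ⟨
    toℕ j + dist (geodesic u z eq i) z  ∎))
    where open ≡-Reasoning

  geodesicPath : ∀ u v → Path (bidirect G) u v
  geodesicPath u v = record
    { len      = dist u v
    ; vertex   = geodesic u v refl
    ; start    = refl
    ; end      = geodesic-end u v refl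
    ; distinct = geodesic-distinct u v refl
    ; edges    = geodesic-edges u v refl
    }

  -- Both the acyclicity of `tree` and the lower bound on all durations rest on this.
  path-length : ∀ {u v} (P : Path (bidirect G) u v) → Path.len P ≡ dist u v
  path-length record { len = n ; vertex = f ; start = refl ; end = refl ; distinct = inj ; edges = es } =
    sym (dist-path n f inj es)

  temporal-length : ∀ {Δ} {lab : Labeling Δ (bidirect G)} {u v} (P : TemporalPath (bidirect G) lab u v) →
                    suc (TemporalPath.len⁻ P) ≡ dist u v
  temporal-length P = path-length record
    { len = suc len⁻ ; vertex = vertex ; start = start ; end = end ; distinct = distinct ; edges = edges }
    where open TemporalPath P

  tree : {{NonZero (Graph.order G)}} → Tree
  tree {{nz}} = record
    { graph     = G
    ; nonempty  = nz
    ; connected = geodesicPath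
    -- An edge between the ends puts them at distance one, hence forces length one on every path
    -- between them.
    ; acyclic   = λ u v P 2≤len e → contradiction 2≤len (<⇒≱ (s≤s (≤-reflexive
                    (trans (path-length P) (dist-edge (Graph.symmetric G v u e))))))
    }

  -- Instances given by the distance matrix

  module _ (Δ : ℕ) .{{_ : NonZero Δ}} {{_ : NonZero (Graph.order G)}} where
    open Modulo Δ

    -- The smallest matrix that slack 0 allows: a fastest path has no time to wait at a vertex.
    tight : DiTTR Δ 0
    tight = record
      { tree     = tree
      ; D        = λ u v → [ dist u v ]
      ; positive = λ u v u≢v → [ n≢0⇒n>0 (u≢v ∘ dist≡0⇒≡) ]
      ; slack    = λ { u v _ d (_ , shortest) →
                       [ ≤-trans (≤-reflexive (+-identityʳ d)) (shortest (geodesicPath u v)) ] }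
      }

    -- `u ≢ v` exempts turning back along an edge, so its two directions are not compared directly.
    -- Values are natural numbers, so `suc` need not wrap around at `Δ`.
    Consecutive : (∀ u v → Edge u v → ℕ) → Set
    Consecutive f = ∀ {u m v} (e : Edge u m) (e′ : Edge m v) → u ≢ v → suc (f u m e) ≈ f m v e′

    toℕ-labels : Labeling Δ (bidirect G) → ∀ u v → Edge u v → ℕ
    toℕ-labels lab u v e = toℕ (lab u v e)

    consecutive-path : ∀ {f} → Consecutive f → ∀ n (p : Fin (suc (suc n)) → Vertex) →
      Injective _≡_ _≡_ p → (es : ∀ i → Edge (p (inject₁ i)) (p (suc i))) →
      ∀ i → f _ _ (es i) ≈ toℕ i + f _ _ (es zero)
    consecutive-path     c n       p inj es zero    = ≈-reflexive refl
    consecutive-path {f} c (suc n) p inj es (suc i) = ≈-trans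
      (consecutive-path {f} c n (p ∘ suc) (Fin.suc-injective ∘ inj) (es ∘ suc) i)
      (≈-trans (≈-+ˡ (toℕ i) (≈-sym (c (es zero) (es 1F) (λ eq → contradiction (inj eq) λ ()))))
               (≈-reflexive (+-suc (toℕ i) _)))

    -- Leaving at the time of the first label, the geodesic is traversed without waiting. Nothing is
    -- faster, since every path has `dist u v` edges at increasing times.
    consecutive⇒valid : ∀ lab → Consecutive (toℕ-labels lab) → Valid tight lab
    consecutive⇒valid lab c u v u≢v = go (dist u v) refl
      where
      duration≥dist : (Q : TemporalPath (bidirect G) lab u v) → dist u v ≤ TemporalPath.duration Q
      duration≥dist Q = begin
        dist u v                                    ≡⟨ temporal-length Q ⟨
        suc len⁻                                    ≡⟨ m+n∸n≡m (suc len⁻) (time zero) ⟨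
        suc (len⁻ + time zero) ∸ time zero          ≤⟨ ∸-monoˡ-≤ (time zero) (s≤s (increasing⇒+≤ time increasing)) ⟩
        suc (time (fromℕ len⁻)) ∸ time zero         ≡⟨ cong (_∸ time zero) (+-comm 1 (time (fromℕ len⁻))) ⟩
        time (fromℕ len⁻) + 1 ∸ time zero           ∎
        where
        open TemporalPath Q
        open ≤-Reasoning

      go : ∀ d → dist u v ≡ d → Σ[ P ∈ TemporalPath (bidirect G) lab u v ]
           IsFastest (bidirect G) lab P × [ TemporalPath.duration P ] ≤⁺ [ dist u v ]
      go zero    eq = contradiction (dist≡0⇒≡ eq) u≢v
      go (suc n) eq =
        P , (λ Q → ≤-trans (≤-reflexive duration≡dist) (duration≥dist Q)) , [ ≤-reflexive duration≡dist ]
        where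
        es = geodesic-edges u v eq
        t₀ = toℕ-labels lab _ _ (es zero)

        P : TemporalPath (bidirect G) lab u v
        P = record
          { len⁻       = n
          ; vertex     = geodesic u v eq
          ; time       = λ i → toℕ i + t₀
          ; start      = refl
          ; end        = geodesic-end u v eq
          ; distinct   = geodesic-distinct u v eq
          ; edges      = es
          ; active     = λ i → active-≈ _
              (consecutive-path {toℕ-labels lab} c n (geodesic u v eq) (geodesic-distinct u v eq) es i)
          ; increasing = λ i j i<j → +-monoˡ-< t₀ i<j
          }

        duration≡dist : TemporalPath.duration P ≡ dist u v
        duration≡dist = begin
          toℕ (fromℕ n) + t₀ + 1 ∸ t₀    ≡⟨ cong (λ k → k + t₀ + 1 ∸ t₀) (Fin.toℕ-fromℕ n) ⟩
          n + t₀ + 1 ∸ t₀                ≡⟨ cong (_∸ t₀) (+-comm (n + t₀) 1) ⟩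
          suc n + t₀ ∸ t₀                ≡⟨ m+n∸n≡m (suc n) t₀ ⟩
          suc n                          ≡⟨ eq ⟨
          dist u v                       ∎
          where open ≡-Reasoning

    -- The entry for `u` and `v` is two, which leaves only a path with two edges at successive
    -- times, and its middle vertex must be `m`.
    valid⇒consecutive : ∀ lab → Valid tight lab → Consecutive (toℕ-labels lab)
    valid⇒consecutive lab valid {u} {m} {v} e e′ u≢v with valid u v u≢v
    ... | P , _ , [ dur ] = go P (trans (temporal-length P) uv≡2)
                              (≤-trans dur (≤-reflexive uv≡2))
      where
      uv≡2 = dist-2 e e′ u≢v

      go : (P : TemporalPath (bidirect G) lab u v) → suc (TemporalPath.len⁻ P) ≡ 2 →
           TemporalPath.duration P ≤ 2 → suc (toℕ-labels lab u m e) ≈ toℕ-labels lab m v e′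
      go record { vertex = p ; time = t ; start = refl ; end = refl ; edges = es
                ; active = act ; increasing = incr } refl dur =
        -- Both `p 1F` and `m` are neighbours of `u` closer to `v`.
        through (closer-unique _ (es zero) e (trans uv≡2 (cong suc (sym (dist-edge (es 1F)))))
                  (trans uv≡2 (cong suc (sym (dist-edge e′)))))
        where
        t₁≤ : t 1F ≤ suc (t zero)
        t₁≤ = ≤-pred (begin
          suc (t 1F)        ≡⟨ +-comm 1 (t 1F) ⟩
          -- This inequality survives truncation in `∸`, so the two times need not be compared
          -- first.
          t 1F + 1          ≤⟨ ≤-trans (m≤n+m∸n (t 1F + 1) (t zero)) (+-monoʳ-≤ (t zero) dur) ⟩
          t zero + 2        ≡⟨ +-comm (t zero) 2 ⟩
          2 + t zero        ∎)
          where open ≤-Reasoning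

        through : p 1F ≡ m → suc (toℕ-labels lab u m e) ≈ toℕ-labels lab m v e′
        -- Labels take the edge proof as an argument; the given proofs are identified with those
        -- stored in the path.
        through refl rewrite T-irrelevant e (es zero) | T-irrelevant e′ (es 1F) =
          ≈-trans (≈-suc (≈-active (act zero)))
            (≈-trans (≈-reflexive (≤-antisym (incr zero 1F (s≤s z≤n)) t₁≤)) (≈-sym (≈-active (act 1F))))

-- Spiders and their distance function

isZero : ∀ {n} → Fin n → Bool
isZero zero    = true
isZero (suc _) = false

-- A star with three leaves whose centre is joined by a path of n further edges to
-- the vertex zero; each stage hangs a new vertex zero on the previous one.
adj : ∀ n → Fin (4 + n) → Fin (4 + n) → Bool
adj _       zero    zero    = false
adj zero    zero    (suc _) = true
adj zero    (suc _) zero    = true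
adj zero    (suc _) (suc _) = false
adj (suc n) zero    (suc v) = isZero v
adj (suc n) (suc u) zero    = isZero u
adj (suc n) (suc u) (suc v) = adj n u v

adj-sym : ∀ n u v → T (adj n u v) → T (adj n v u)
adj-sym zero    zero    (suc _) e = _
adj-sym zero    (suc _) zero    e = _
adj-sym (suc n) zero    (suc v) e = e
adj-sym (suc n) (suc u) zero    e = e
adj-sym (suc n) (suc u) (suc v) e = adj-sym n u v e

adj-irrefl : ∀ n u → ¬ T (adj n u u)
adj-irrefl (suc n) (suc u) e = adj-irrefl n u e

spider : ℕ → Graph
spider n = record
  { order = 4 + n ; adj = adj n ; symmetric = adj-sym n ; irreflexive = adj-irrefl n }

leafDist : ∀ {n} → Fin n → Fin n → ℕ
leafDist i j with i Fin.≟ j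
... | yes _ = 0
... | no  _ = 2

leafDist-refl : ∀ {n} (i : Fin n) → leafDist i i ≡ 0
leafDist-refl i with i Fin.≟ i
... | yes _   = refl
... | no  i≢i = contradiction refl i≢i

leafDist≡0⇒≡ : ∀ {n} (i j : Fin n) → leafDist i j ≡ 0 → i ≡ j
leafDist≡0⇒≡ i j eq with i Fin.≟ j | eq
... | yes i≡j | _ = i≡j

spiderDist : ∀ n → Fin (4 + n) → Fin (4 + n) → ℕ
spiderDist _       zero    zero    = 0
spiderDist zero    zero    (suc _) = 1
spiderDist zero    (suc _) zero    = 1
spiderDist zero    (suc i) (suc j) = leafDist i j
spiderDist (suc n) zero    (suc v) = suc (spiderDist n zero v)
spiderDist (suc n) (suc u) zero    = suc (spiderDist n u zero)
spiderDist (suc n) (suc u) (suc v) = spiderDist n u v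

spiderDist-refl : ∀ n u → spiderDist n u u ≡ 0
spiderDist-refl n       zero    = refl
spiderDist-refl zero    (suc i) = leafDist-refl i
spiderDist-refl (suc n) (suc u) = spiderDist-refl n u

spiderDist≡0⇒≡ : ∀ n u v → spiderDist n u v ≡ 0 → u ≡ v
spiderDist≡0⇒≡ n       zero    zero    eq = refl
spiderDist≡0⇒≡ zero    (suc i) (suc j) eq = cong suc (leafDist≡0⇒≡ i j eq)
spiderDist≡0⇒≡ (suc n) (suc u) (suc v) eq = cong suc (spiderDist≡0⇒≡ n u v eq)
spiderDist≡0⇒≡ zero    zero    (suc _) ()
spiderDist≡0⇒≡ zero    (suc _) zero    ()
spiderDist≡0⇒≡ (suc _) zero    (suc _) ()
spiderDist≡0⇒≡ (suc _) (suc _) zero    ()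

spiderDist-step : ∀ n u w → T (adj n u w) → ∀ z →
  spiderDist n u z ≡ suc (spiderDist n w z) ⊎ spiderDist n w z ≡ suc (spiderDist n u z)
spiderDist-step zero zero (suc i) e zero = inj₂ refl
spiderDist-step zero zero (suc i) e (suc j) with i Fin.≟ j
... | yes _ = inj₁ refl
... | no  _ = inj₂ refl
spiderDist-step zero (suc i) zero e zero = inj₁ refl
spiderDist-step zero (suc i) zero e (suc j) with i Fin.≟ j
... | yes _ = inj₂ refl
... | no  _ = inj₁ refl
spiderDist-step (suc n) zero (suc zero) e zero    = inj₂ refl
spiderDist-step (suc n) zero (suc zero) e (suc z) = inj₁ refl
spiderDist-step (suc n) (suc zero) zero e zero    = inj₁ refl
spiderDist-step (suc n) (suc zero) zero e (suc z) = inj₂ refl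
spiderDist-step (suc n) (suc u) (suc w) e zero with spiderDist-step n u w e zero
... | inj₁ eq = inj₁ (cong suc eq)
... | inj₂ eq = inj₂ (cong suc eq)
spiderDist-step (suc n) (suc u) (suc w) e (suc z) = spiderDist-step n u w e z

spider-closer : ∀ n {d} u z → spiderDist n u z ≡ suc d →
                Σ[ w ∈ Fin (4 + n) ] T (adj n u w) × spiderDist n w z ≡ d
spider-closer zero zero    (suc j) refl = suc j , _ , leafDist-refl j
spider-closer zero (suc i) zero    refl = zero , _ , refl
spider-closer zero (suc i) (suc j) eq with i Fin.≟ j | eq
... | no _ | refl = zero , _ , refl
spider-closer (suc n) zero (suc z) refl = 1F , _ , refl
spider-closer (suc n) (suc zero)    zero refl = zero , _ , refl
spider-closer (suc n) (suc (suc u)) zero refl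
  with spiderDist n (suc u) zero in eq
-- In the previous stage the vertex `suc u` differs from `zero`, so its distance there is positive
-- and the recursion applies.
... | zero = contradiction (spiderDist≡0⇒≡ n (suc u) zero eq) λ ()
... | suc d with spider-closer n (suc u) zero eq
...   | w , e , eq′ = suc w , e , cong suc eq′
spider-closer (suc n) (suc u) (suc z) eq with spider-closer n u z eq
... | w , e , eq′ = suc w , e , eq′

spider-closer-unique : ∀ n w u v z → T (adj n w u) → T (adj n w v) →
  spiderDist n w z ≡ suc (spiderDist n u z) → spiderDist n w z ≡ suc (spiderDist n v z) → u ≡ v
-- A leaf closer to `suc l` than the centre is at distance zero from it, so it is `suc l` itself.
spider-closer-unique zero zero (suc i) (suc j) (suc l) e e′ p q = cong suc (trans
  (leafDist≡0⇒≡ i l (suc-injective (sym p))) (sym (leafDist≡0⇒≡ j l (suc-injective (sym q)))))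
spider-closer-unique zero (suc _) zero zero z e e′ p q = refl
spider-closer-unique (suc n) zero (suc zero) (suc zero) z e e′ p q = refl
spider-closer-unique (suc n) (suc w) zero zero z e e′ p q = refl
spider-closer-unique (suc n) (suc zero) zero (suc v) zero e e′ p ()
-- Moving out to the new `zero` leads away from `suc z`: `p` would equate a number with itself plus
-- two.
spider-closer-unique (suc n) (suc zero) zero (suc v) (suc z) e e′ p q = contradiction p (m≢1+n+m _ {1})
spider-closer-unique (suc n) (suc zero) (suc u) zero zero e e′ () q
spider-closer-unique (suc n) (suc zero) (suc u) zero (suc z) e e′ p q = contradiction q (m≢1+n+m _ {1})
spider-closer-unique (suc n) (suc w) (suc u) (suc v) zero e e′ p q =
  cong suc (spider-closer-unique n w u v zero e e′ (suc-injective p) (suc-injective q))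
spider-closer-unique (suc n) (suc w) (suc u) (suc v) (suc z) e e′ p q =
  cong suc (spider-closer-unique n w u v z e e′ p q)

spiderMetric : ∀ n → TreeMetric (spider n)
spiderMetric n = record
  { dist          = spiderDist n
  ; dist-refl     = spiderDist-refl n
  ; dist≡0⇒≡      = spiderDist≡0⇒≡ n _ _
  ; dist-step     = λ {u} {w} → spiderDist-step n u w
  ; closer        = spider-closer n
  ; closer-unique = λ {w} {u} {v} → spider-closer-unique n w u v
  }

adj-zero-1F : ∀ n → T (adj n zero 1F)
adj-zero-1F zero    = _
adj-zero-1F (suc n) = _

-- Labels of the spider and the gadget

module _ (k : ℕ) where

  open Modulo (suc (k * 2))

  -- Labels increase by one towards zero and, because k * 2 ≈ -1, also by one away from it.
  label : ∀ n → Fin (4 + n) → Fin (4 + n) → ℕ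
  label n       zero    _       = suc (n * (k * 2))
  label zero    (suc _) _       = 0
  label (suc n) (suc _) zero    = suc n
  label (suc n) (suc u) (suc v) = label n u v

  label-to-zero : ∀ n u → label n (suc u) zero ≡ n
  label-to-zero zero    u = refl
  label-to-zero (suc n) u = refl

  label-consecutive : ∀ n u m v → T (adj n u m) → T (adj n m v) → u ≢ v →
                      suc (label n u m) ≈ label n m v
  label-consecutive zero zero    (suc i) zero    e e′ u≢v = contradiction refl u≢v
  label-consecutive zero (suc i) zero    (suc j) e e′ u≢v = ≈-reflexive refl
  label-consecutive (suc n) zero       (suc zero) zero       e e′ u≢v = contradiction refl u≢v
  label-consecutive (suc n) (suc zero) zero       (suc zero) e e′ u≢v = contradiction refl u≢v
  -- Away from `zero` the label drops by `k * 2`; together with the `suc` this is one full period.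
  label-consecutive (suc n) zero (suc zero) (suc v) e e′ u≢v =
    ≈-trans (≈-reflexive (lemma n k)) (+Δ≈ (suc (n * (k * 2))))
    where
    lemma : ∀ n k → suc (suc (suc n * (k * 2))) ≡ suc (n * (k * 2)) + suc (k * 2)
    lemma = solve-∀
  label-consecutive (suc n) (suc zero)    (suc zero) zero e e′ u≢v = contradiction e (adj-irrefl n zero)
  label-consecutive (suc n) (suc (suc u)) (suc zero) zero e e′ u≢v =
    ≈-reflexive (cong suc (label-to-zero n u))
  label-consecutive (suc n) (suc u) (suc m) (suc v) e e′ u≢v =
    label-consecutive n u m v e e′ (u≢v ∘ cong suc)

  -- The gap between the two directions is `n * 2` minus one; the `suc` on the left avoids the
  -- subtraction, which at the centre would give minus one. Generality in `f` lets the induction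
  -- restrict it to the previous stage.
  zero-edge-gap : ∀ n {f} → Consecutive (spiderMetric n) (suc (k * 2)) f →
    ∀ v (e : T (adj n zero v)) (e′ : T (adj n v zero)) → suc (f v zero e′) ≈ n * 2 + f zero v e
  zero-edge-gap zero {f} c (suc i) e e′ =
    -- The edges from leaves `i` and `j` into the centre both precede the edge to `l`, hence agree;
    -- the one from `j` also precedes the edge to `i`.
    let j , l , i≢j , i≢l , j≢l = others i in
    ≈-trans (c {suc i} {zero} {suc l} _ _ (i≢l ∘ Fin.suc-injective))
      (≈-trans (≈-sym (c {suc j} {zero} {suc l} _ _ (j≢l ∘ Fin.suc-injective)))
               (c {suc j} {zero} {suc i} _ _ (i≢j ∘ sym ∘ Fin.suc-injective)))
    where
    others : (i : Fin 3) → Σ[ j ∈ Fin 3 ] Σ[ l ∈ Fin 3 ] i ≢ j × i ≢ l × j ≢ l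
    others zero = 1F , 2F , (λ ()) , (λ ()) , λ ()
    others 1F   = zero , 2F , (λ ()) , (λ ()) , λ ()
    others 2F   = zero , 1F , (λ ()) , (λ ()) , λ ()
  zero-edge-gap (suc n) {f} c (suc zero) e e′ =
    -- Here `1F` is the previous `zero` and `2F` a neighbour of it. Passing to the new edge adds one
    -- to the gap for each direction.
    let a  = adj-zero-1F n
        a′ = adj-sym n zero 1F a in
    ≈-suc (≈-trans (≈-sym (c {2F} {1F} {zero} a′ e′ λ ()))
      (≈-trans (zero-edge-gap n {λ u v → f (suc u) (suc v)}
                  (λ e₁ e₂ u≢v → c e₁ e₂ (u≢v ∘ Fin.suc-injective)) 1F a a′)
        (≈-trans (≈-+ˡ (n * 2) (≈-sym (c {zero} {1F} {2F} e a λ ())))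
                 (≈-reflexive (+-suc (n * 2) _)))))

  -- With `suc k` path edges the gap on the last one is `suc k * 2` minus one, exactly the period.
  gadget : DiTTR (suc (k * 2)) 0
  gadget = tight (spiderMetric (suc k)) (suc (k * 2))

  gadget-realizable : Realizable gadget
  gadget-realizable = lab , consecutive⇒valid (spiderMetric (suc k)) (suc (k * 2)) lab
    λ {u} {m} {v} e e′ u≢v →
      ≈-trans (≈-suc (toℕ-mod-≈ (label (suc k) u m)))
        (≈-trans (label-consecutive (suc k) u m v e e′ u≢v) (≈-sym (toℕ-mod-≈ (label (suc k) m v))))
    where
    lab : Labeling (suc (k * 2)) (bidirect (spider (suc k)))
    lab u v _ = label (suc k) u v mod suc (k * 2)

  gadget-enforces : EnforcesEqual gadget zero 1F _
  gadget-enforces lab valid = sym (toℕ-≈-injective (≈-pred (≈-trans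
    (zero-edge-gap (suc k) {λ u v e → toℕ (lab u v e)}
      (valid⇒consecutive (spiderMetric (suc k)) (suc (k * 2)) lab valid) 1F _ _)
    -- `suc k * 2` reduces to one more than the period, so the right side is `suc` of a full period
    -- plus the label.
    (≈-suc (≈-trans (≈-reflexive (+-comm (suc (k * 2)) _)) (+Δ≈ _))))))

-- All odd periods

odd⇒1+2k : ∀ n → ¬ (2 ∣ n) → ∃[ k ] n ≡ suc (k * 2)
odd⇒1+2k n 2∤n with n % 2 in eq | m%n<n n 2 | m≡m%n+[m/n]*n n 2
... | 0           | _             | _ = contradiction (m%n≡0⇒n∣m n 2 eq) 2∤n
... | 1           | _             | n≡ = n / 2 , n≡
... | suc (suc _) | s≤s (s≤s ()) | _

lemma14 : (Δ : ℕ) → 1 ≤ Δ → ¬ (2 ∣ Δ) →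
    Σ[ I ∈ DiTTR Δ 0 ]
    Realizable I ×
    (Σ[ v₁ ∈ DiTTR.Vertex I ] Σ[ v₂ ∈ DiTTR.Vertex I ] Σ[ e ∈ DiTTR.Edge I v₁ v₂ ]
    EnforcesEqual I v₁ v₂ e)
lemma14 Δ _ 2∤Δ with odd⇒1+2k Δ 2∤Δ
... | k , refl = gadget k , gadget-realizable k , zero , 1F , _ , gadget-enforces k
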